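{- For every positive integer $n$, $$\sum_{k=0}^{n-1}\frac{q^{ -k(k-1)/2}}{\genfrac{[}{]}{0pt}{}{n}{k}_q}=\frac{(q^2;q)_n}{(q^2;q^2)_n}\sum_{i=0}^{n-1}\frac{C(i)\,(q^2;q^2)_i}{(q^2;q)_i\,(q^{i+2}-1)},$$ where $$C(i)=\frac{q^{i+1}+q^{3(i+1)}+q^{ -i(i-1)/2}+q^{ -(i+1)(i-4)/2}-q^{(2+3i-i^2)/2}-q^{ -(i+1)(i-2)/2}-2q^{2(i+1)}}{q^{i+1}-1}.$$ (The identity is an identity of rational functions in the indeterminate $q$.)
   Context: For an indeterminate $q$ and any $a$, $(a;q)_n=(1-a)(1-aq)\cdots(1-aq^{n-1})$, with $(a;q)_0=1$. The $q$-binomial coefficient is $\genfrac{[}{]}{0pt}{}{n}{k}_q=\frac{(q;q)_n}{(q;q)_k\,(q;q)_{n-k}}$ for $0\le k\le n$. -}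

module Defs where

open import Algebra.Bundles.Raw using (RawRing)
import Algebra.Definitions.RawSemiring as RawSemiringDefinitions
open import Data.Empty using (⊥-elim-irr)
open import Data.Fin.Base using (Fin; zero; suc; toℕ)
open import Data.Integer.Base as ℤ using (ℤ; +_; -[1+_])
open import Data.List.Base using (List; []; _∷_; map)
open import Data.Nat.Base as ℕ using (ℕ; zero; suc)
open import Data.Rational.Base as ℚ using (ℚ; 0ℚ; 1ℚ)
import Data.Rational.Properties as ℚ
open import Data.Sum.Base as Sum using (_⊎_; inj₁; inj₂; [_,_]′)
open import Level using (0ℓ)
open import Relation.Binary.PropositionalEquality
open import Relation.Nullary using (¬_; yes; no)

-- Coefficients in order of increasing degree; trailing zeros are allowed,
-- so polynomials are compared with _≈ₚ_ rather than _≡_.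
ℚ[q] : Set
ℚ[q] = List ℚ

coeff : ℚ[q] → ℕ → ℚ
coeff []      _       = 0ℚ
coeff (a ∷ p) zero    = a
coeff (a ∷ p) (suc i) = coeff p i

infix 4 _≈ₚ_ _≉ₚ_

record _≈ₚ_ (p r : ℚ[q]) : Set where
  constructor pointwise
  field
    at : ∀ i → coeff p i ≡ coeff r i

open _≈ₚ_ public

_≉ₚ_ : ℚ[q] → ℚ[q] → Set
p ≉ₚ r = ¬ (p ≈ₚ r)

infixl 6 _+ₚ_
infixl 7 _*ₚ_ _·ₚ_
infix  8 -ₚ_

0ₚ 1ₚ qₚ : ℚ[q]
0ₚ = []
1ₚ = 1ℚ ∷ []
qₚ = 0ℚ ∷ 1ℚ ∷ []

_+ₚ_ : ℚ[q] → ℚ[q] → ℚ[q]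
[]      +ₚ r       = r
(a ∷ p) +ₚ []      = a ∷ p
(a ∷ p) +ₚ (b ∷ r) = a ℚ.+ b ∷ p +ₚ r

-ₚ_ : ℚ[q] → ℚ[q]
-ₚ p = map (λ a → ℚ.- a) p

_·ₚ_ : ℚ → ℚ[q] → ℚ[q]
a ·ₚ r = map (a ℚ.*_) r

_*ₚ_ : ℚ[q] → ℚ[q] → ℚ[q]
[]      *ₚ r = []
(a ∷ p) *ₚ r = (a ·ₚ r) +ₚ (0ℚ ∷ p *ₚ r)

coeff-+ : ∀ p r i → coeff (p +ₚ r) i ≡ coeff p i ℚ.+ coeff r i
coeff-+ []      r       i       = sym (ℚ.+-identityˡ _)
coeff-+ (a ∷ p) []      i       = sym (ℚ.+-identityʳ _)
coeff-+ (a ∷ p) (b ∷ r) zero    = refl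
coeff-+ (a ∷ p) (b ∷ r) (suc i) = coeff-+ p r i

coeff-neg : ∀ p i → coeff (-ₚ p) i ≡ ℚ.- coeff p i
coeff-neg []      i       = refl
coeff-neg (a ∷ p) zero    = refl
coeff-neg (a ∷ p) (suc i) = coeff-neg p i

coeff-· : ∀ a r i → coeff (a ·ₚ r) i ≡ a ℚ.* coeff r i
coeff-· a []      i       = sym (ℚ.*-zeroʳ a)
coeff-· a (b ∷ r) zero    = refl
coeff-· a (b ∷ r) (suc i) = coeff-· a r i

coeff-*-step : ∀ a p r i →
  coeff ((a ∷ p) *ₚ r) i ≡ a ℚ.* coeff r i ℚ.+ coeff (0ℚ ∷ p *ₚ r) i
coeff-*-step a p r i =
  trans (coeff-+ (a ·ₚ r) (0ℚ ∷ p *ₚ r) i) (cong (ℚ._+ _) (coeff-· a r i))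

coeff-*-zero : ∀ p r → coeff (p *ₚ r) 0 ≡ coeff p 0 ℚ.* coeff r 0
coeff-*-zero []      r = sym (ℚ.*-zeroˡ (coeff r 0))
coeff-*-zero (a ∷ p) r = trans (coeff-*-step a p r 0) (ℚ.+-identityʳ _)

∷-≈0 : ∀ {a p} → a ≡ 0ℚ → p ≈ₚ 0ₚ → a ∷ p ≈ₚ 0ₚ
∷-≈0 a≡0 p≈0 .at zero    = a≡0
∷-≈0 a≡0 p≈0 .at (suc i) = p≈0 .at i

tail-≈0 : ∀ {a p} → a ∷ p ≈ₚ 0ₚ → p ≈ₚ 0ₚ
tail-≈0 p≈0 .at i = p≈0 .at (suc i)

≈ₚ-trans : ∀ {p r s} → p ≈ₚ r → r ≈ₚ s → p ≈ₚ s
≈ₚ-trans p≈r r≈s .at i = trans (p≈r .at i) (r≈s .at i)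

≈ₚ-sym : ∀ {p r} → p ≈ₚ r → r ≈ₚ p
≈ₚ-sym p≈r .at i = sym (p≈r .at i)

*ₚ-zeroˡ : ∀ p r → p ≈ₚ 0ₚ → p *ₚ r ≈ₚ 0ₚ
*ₚ-zeroˡ []      r p≈0 .at i = refl
*ₚ-zeroˡ (a ∷ p) r p≈0 .at i = trans (coeff-*-step a p r i) (cong₂ ℚ._+_
  (trans (cong (ℚ._* coeff r i) (p≈0 .at 0)) (ℚ.*-zeroˡ (coeff r i)))
  (∷-≈0 refl (*ₚ-zeroˡ p r (tail-≈0 p≈0)) .at i))

0∷-*ₚ : ∀ {a} → a ≡ 0ℚ → ∀ p r → (a ∷ p) *ₚ r ≈ₚ 0ℚ ∷ p *ₚ r
0∷-*ₚ refl p r .at i = trans (coeff-*-step 0ℚ p r i)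
  (trans (cong (ℚ._+ coeff (0ℚ ∷ p *ₚ r) i) (ℚ.*-zeroˡ (coeff r i))) (ℚ.+-identityˡ _))

*ₚ-0∷ : ∀ {b} → b ≡ 0ℚ → ∀ p r → p *ₚ (b ∷ r) ≈ₚ 0ℚ ∷ p *ₚ r
*ₚ-0∷ b≡0  []      r .at zero    = refl
*ₚ-0∷ b≡0  []      r .at (suc i) = refl
*ₚ-0∷ refl (a ∷ p) r .at zero    = trans (coeff-*-zero (a ∷ p) (0ℚ ∷ r)) (ℚ.*-zeroʳ a)
*ₚ-0∷ {b} b≡0 (a ∷ p) r .at (suc i) = trans (coeff-*-step a p (b ∷ r) (suc i))
  (trans (cong (λ c → a ℚ.* coeff r i ℚ.+ c) (*ₚ-0∷ b≡0 p r .at i)) (sym (coeff-*-step a p r i)))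

p*q≡0⇒p≡0∨q≡0 : ∀ a b → a ℚ.* b ≡ 0ℚ → a ≡ 0ℚ ⊎ b ≡ 0ℚ
p*q≡0⇒p≡0∨q≡0 a b ab≡0 with a ℚ.≟ 0ℚ
... | yes a≡0 = inj₁ a≡0
... | no  a≢0 = inj₂ (begin
  b                        ≡⟨ ℚ.*-identityˡ b ⟨
  1ℚ ℚ.* b                 ≡⟨ cong (ℚ._* b) (ℚ.*-inverseˡ a) ⟨
  (ℚ.1/ a ℚ.* a) ℚ.* b     ≡⟨ ℚ.*-assoc (ℚ.1/ a) a b ⟩
  ℚ.1/ a ℚ.* (a ℚ.* b)     ≡⟨ cong (ℚ.1/ a ℚ.*_) ab≡0 ⟩
  ℚ.1/ a ℚ.* 0ℚ            ≡⟨ ℚ.*-zeroʳ (ℚ.1/ a) ⟩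
  0ℚ                       ∎)
  where
  open ≡-Reasoning
  instance
    _ : ℚ.NonZero a
    _ = ℚ.≢-nonZero a≢0

*ₚ-domain : ∀ p r → p *ₚ r ≈ₚ 0ₚ → p ≈ₚ 0ₚ ⊎ r ≈ₚ 0ₚ
*ₚ-domain []      r       pr≈0 = inj₁ (pointwise λ _ → refl)
*ₚ-domain (a ∷ p) []      pr≈0 = inj₂ (pointwise λ _ → refl)
*ₚ-domain (a ∷ p) (b ∷ r) pr≈0 =
  [ (λ a≡0 → Sum.map₁ (∷-≈0 a≡0)
      (*ₚ-domain p (b ∷ r) (tail-≈0 (≈ₚ-trans (≈ₚ-sym (0∷-*ₚ a≡0 p (b ∷ r))) pr≈0))))
  , (λ b≡0 → Sum.map₂ (∷-≈0 b≡0)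
      (*ₚ-domain (a ∷ p) r (tail-≈0 (≈ₚ-trans (≈ₚ-sym (*ₚ-0∷ b≡0 (a ∷ p) r)) pr≈0))))
  ]′ (p*q≡0⇒p≡0∨q≡0 a b (trans (sym (coeff-*-zero (a ∷ p) (b ∷ r))) (pr≈0 .at 0)))

*ₚ-≉0 : ∀ {p r} → p ≉ₚ 0ₚ → r ≉ₚ 0ₚ → p *ₚ r ≉ₚ 0ₚ
*ₚ-≉0 {p} {r} p≉0 r≉0 pr≈0 = [ p≉0 , r≉0 ]′ (*ₚ-domain p r pr≈0)

1ₚ≉0 : 1ₚ ≉ₚ 0ₚ
1ₚ≉0 1≈0 = ℚ.1≢0 (1≈0 .at 0)

record ℚ⟨q⟩ : Set where
  no-eta-equality
  constructor mk
  field
    num   : ℚ[q]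
    den   : ℚ[q]
    den≉0 : den ≉ₚ 0ₚ

open ℚ⟨q⟩ public

infix 4 _≈_ _≉_

record _≈_ (x y : ℚ⟨q⟩) : Set where
  constructor cross
  field
    cross-eq : num x *ₚ den y ≈ₚ num y *ₚ den x

open _≈_ public

_≉_ : ℚ⟨q⟩ → ℚ⟨q⟩ → Set
x ≉ y = ¬ (x ≈ y)

infixl 6 _+_ _-_
infixl 7 _*_ _÷_
infix  8 -_

fromPoly : ℚ[q] → ℚ⟨q⟩
num   (fromPoly p) = p
den   (fromPoly p) = 1ₚ
den≉0 (fromPoly p) = 1ₚ≉0

0# 1# q : ℚ⟨q⟩
0# = fromPoly 0ₚ
1# = fromPoly 1ₚ
q  = fromPoly qₚ

_+_ _*_ : ℚ⟨q⟩ → ℚ⟨q⟩ → ℚ⟨q⟩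

num   (x + y) = num x *ₚ den y +ₚ num y *ₚ den x
den   (x + y) = den x *ₚ den y
den≉0 (x + y) = *ₚ-≉0 (den≉0 x) (den≉0 y)

num   (x * y) = num x *ₚ num y
den   (x * y) = den x *ₚ den y
den≉0 (x * y) = *ₚ-≉0 (den≉0 x) (den≉0 y)

-_ : ℚ⟨q⟩ → ℚ⟨q⟩
num   (- x) = -ₚ num x
den   (- x) = den x
den≉0 (- x) = den≉0 x

_-_ : ℚ⟨q⟩ → ℚ⟨q⟩ → ℚ⟨q⟩
x - y = x + (- y)

record NonZero (x : ℚ⟨q⟩) : Set where
  field
    nonZero : x ≉ 0#

num≉0 : ∀ x → NonZero x → num x ≉ₚ 0ₚ
num≉0 x x≉0 n≈0 = NonZero.nonZero x≉0 (cross (*ₚ-zeroˡ (num x) 1ₚ n≈0))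

≉0-num : ∀ {x} → num x ≉ₚ 0ₚ → NonZero x
≉0-num {x} n≉0 .NonZero.nonZero (cross eq) = *ₚ-≉0 n≉0 1ₚ≉0 eq

_÷_ : (x y : ℚ⟨q⟩) .{{_ : NonZero y}} → ℚ⟨q⟩
num   (x ÷ y) = num x *ₚ den y
den   (x ÷ y) = den x *ₚ num y
den≉0 (_÷_ x y {{y≉0}}) d≈0 = ⊥-elim-irr (*ₚ-≉0 (den≉0 x) (num≉0 y y≉0) d≈0)

rawRing : RawRing 0ℓ 0ℓ
rawRing = record
  { Carrier = ℚ⟨q⟩ ; _≈_ = _≈_ ; _+_ = _+_ ; _*_ = _*_ ; -_ = -_ ; 0# = 0# ; 1# = 1# }

open RawSemiringDefinitions (RawRing.rawSemiring rawRing) public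
  using (_×_; _^_; sum; product)

*-nonZero : ∀ {x y} → NonZero x → NonZero y → NonZero (x * y)
*-nonZero {x} {y} x≉0 y≉0 = ≉0-num (*ₚ-≉0 (num≉0 x x≉0) (num≉0 y y≉0))

÷-nonZero : ∀ {x y} → NonZero x → (y≉0 : NonZero y) → NonZero (_÷_ x y {{y≉0}})
÷-nonZero {x} {y} x≉0 _ = ≉0-num (*ₚ-≉0 (num≉0 x x≉0) (den≉0 y))

1-nonZero : NonZero 1#
1-nonZero = ≉0-num 1ₚ≉0

^-nonZero : ∀ {x} → NonZero x → ∀ n → NonZero (x ^ n)
^-nonZero x≉0 zero    = 1-nonZero
^-nonZero x≉0 (suc n) = *-nonZero x≉0 (^-nonZero x≉0 n)

instance
  q-nonZero : NonZero q
  q-nonZero = ≉0-num (λ eq → ℚ.1≢0 (eq .at 1))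

-- A sufficient condition for x to be regular at q = 0 with value v.
record At0 (x : ℚ⟨q⟩) (v : ℚ) : Set where
  constructor _,_
  field
    num₀ : coeff (num x) 0 ≡ v
    den₀ : coeff (den x) 0 ≡ 1ℚ

at0-nonZero : ∀ {x v} → v ≢ 0ℚ → At0 x v → NonZero x
at0-nonZero v≢0 (n , _) = ≉0-num λ eq → v≢0 (trans (sym n) (eq .at 0))

at0-* : ∀ {x y v w} → At0 x v → At0 y w → At0 (x * y) (v ℚ.* w)
at0-* {x} {y} (n , d) (n′ , d′) =
  trans (coeff-*-zero (num x) (num y)) (cong₂ ℚ._*_ n n′) ,
  trans (coeff-*-zero (den x) (den y)) (cong₂ ℚ._*_ d d′)

at0-+ : ∀ {x y v w} → At0 x v → At0 y w → At0 (x + y) (v ℚ.+ w)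
at0-+ {x} {y} {v} {w} (n , d) (n′ , d′) =
  trans (coeff-+ (num x *ₚ den y) (num y *ₚ den x) 0) (cong₂ ℚ._+_
    (trans (coeff-*-zero (num x) (den y)) (trans (cong₂ ℚ._*_ n d′) (ℚ.*-identityʳ v)))
    (trans (coeff-*-zero (num y) (den x)) (trans (cong₂ ℚ._*_ n′ d) (ℚ.*-identityʳ w)))) ,
  trans (coeff-*-zero (den x) (den y)) (cong₂ ℚ._*_ d d′)

at0-neg : ∀ {x v} → At0 x v → At0 (- x) (ℚ.- v)
at0-neg {x} (n , d) = trans (coeff-neg (num x) 0) (cong (λ a → ℚ.- a) n) , d

at0-1 : At0 1# 1ℚ
at0-1 = refl , refl

at0-q : At0 q 0ℚ
at0-q = refl , refl

at0-*-vanishes : ∀ {x y v} → At0 x 0ℚ → At0 y v → At0 (x * y) 0ℚ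
at0-*-vanishes {v = v} x₀ y₀ = subst (At0 _) (ℚ.*-zeroˡ v) (at0-* x₀ y₀)

at0-^ : ∀ {x} → At0 x 0ℚ → ∀ n → At0 (x ^ suc n) 0ℚ
at0-^ x₀ zero    = at0-*-vanishes x₀ at0-1
at0-^ x₀ (suc n) = at0-*-vanishes x₀ (at0-^ x₀ n)

infixr 8 _^ᶻ_

_^ᶻ_ : (x : ℚ⟨q⟩) (e : ℤ) .{{_ : NonZero x}} → ℚ⟨q⟩
x ^ᶻ (+ n) = x ^ n
_^ᶻ_ x -[1+ n ] {{x≉0}} = _÷_ 1# (x ^ suc n) {{^-nonZero x≉0 (suc n)}}

∑< : ℕ → (ℕ → ℚ⟨q⟩) → ℚ⟨q⟩
∑< n f = sum {n} (λ k → f (toℕ k))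

infixr 5 ∑<
syntax ∑< n (λ k → e) = ∑[ k < n ] e

-- ⟨ a ⨾ b ⟩ n  is the q-Pochhammer symbol (a ; b)ₙ to base b.
infix 9 ⟨_⨾_⟩_

⟨_⨾_⟩_ : ℚ⟨q⟩ → ℚ⟨q⟩ → ℕ → ℚ⟨q⟩
⟨ a ⨾ b ⟩ n = product {n} (λ j → 1# - a * b ^ toℕ j)

product-at0 : ∀ {n} (f : Fin n → ℚ⟨q⟩) → (∀ j → At0 (f j) 1ℚ) → At0 (product f) 1ℚ
product-at0 {zero}  f f₀ = at0-1
product-at0 {suc n} f f₀ = at0-* {f zero} (f₀ zero) (product-at0 (λ j → f (suc j)) λ j → f₀ (suc j))

⨾-nonZero : ∀ {a b} → At0 a 0ℚ → At0 b 0ℚ → ∀ n → NonZero (⟨ a ⨾ b ⟩ n)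
⨾-nonZero {a} {b} a₀ b₀ n =
  at0-nonZero ℚ.1≢0 (product-at0 _ λ (j : Fin n) → at0-+ at0-1 (at0-neg (a*b^ (toℕ j))))
  where
  a*b^ : ∀ j → At0 (a * b ^ j) 0ℚ
  a*b^ zero    = at0-*-vanishes a₀ at0-1
  a*b^ (suc j) = at0-*-vanishes a₀ (at0-^ b₀ j)

⟨q⨾q⟩-nonZero : ∀ n → NonZero (⟨ q ⨾ q ⟩ n)
⟨q⨾q⟩-nonZero = ⨾-nonZero at0-q at0-q

⟨q²⨾q⟩-nonZero : ∀ n → NonZero (⟨ q ^ 2 ⨾ q ⟩ n)
⟨q²⨾q⟩-nonZero = ⨾-nonZero (at0-^ at0-q 1) at0-q

⟨q²⨾q²⟩-nonZero : ∀ n → NonZero (⟨ q ^ 2 ⨾ q ^ 2 ⟩ n)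
⟨q²⨾q²⟩-nonZero = ⨾-nonZero (at0-^ at0-q 1) (at0-^ at0-q 1)

q^[1+n]-1-nonZero : ∀ n → NonZero (q ^ suc n - 1#)
q^[1+n]-1-nonZero n = at0-nonZero (λ ()) (at0-+ (at0-^ at0-q n) (at0-neg at0-1))

-- The q-binomial coefficient; only meaningful for k ≤ n.
qbinom : ℕ → ℕ → ℚ⟨q⟩
qbinom n k = (⟨ q ⨾ q ⟩ n ÷ (⟨ q ⨾ q ⟩ k * ⟨ q ⨾ q ⟩ (n ℕ.∸ k)))
  {{*-nonZero (⟨q⨾q⟩-nonZero k) (⟨q⨾q⟩-nonZero (n ℕ.∸ k))}}

qbinom-nonZero : ∀ n k → NonZero (qbinom n k)
qbinom-nonZero n k = ÷-nonZero (⟨q⨾q⟩-nonZero n)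
  (*-nonZero (⟨q⨾q⟩-nonZero k) (⟨q⨾q⟩-nonZero (n ℕ.∸ k)))

-- Every numerator halved below is even, so the integer division is exact.
C : ℕ → ℚ⟨q⟩
C i = ((
    q ^ᶻ (I ℤ.+ + 1)
  + q ^ᶻ (+ 3 ℤ.* (I ℤ.+ + 1))
  + q ^ᶻ (ℤ.- (I ℤ.* (I ℤ.- + 1)) ℤ./ + 2)
  + q ^ᶻ (ℤ.- ((I ℤ.+ + 1) ℤ.* (I ℤ.- + 4)) ℤ./ + 2)
  - q ^ᶻ ((+ 2 ℤ.+ + 3 ℤ.* I ℤ.- I ℤ.* I) ℤ./ + 2)
  - q ^ᶻ (ℤ.- ((I ℤ.+ + 1) ℤ.* (I ℤ.- + 2)) ℤ./ + 2)
  - 2 × q ^ᶻ (+ 2 ℤ.* (I ℤ.+ + 1))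
  ) ÷ (q ^ suc i - 1#)) {{q^[1+n]-1-nonZero i}}
  where
  I : ℤ
  I = + i

{-# OPTIONS --safe #-}
module Submission where

-- The reciprocals of the q-binomial coefficients satisfy, for k ≤ n,
--   (1 - q^(n+1)) (1/[n+1,k] + q^(n+1-k)/[n+1,k+1]) = (1 - q^(n+2))/[n,k].
-- Multiplied by q^(-k(k-1)/2) and summed over k < n, this gives for the left-hand side S(n)
--   (1 - q^(2n+2)) S(n+1) = (1 - q^(n+2)) S(n) - C(n),
-- because the boundary terms add up to -C(n) = (1 - q) q^(-n(n-1)/2) + (1 - q^(n+1)) q^(n+1).
-- The right-hand side solves the same recurrence by variation of constants: its prefactor
-- solves the homogeneous equation, and its sum supplies the inhomogeneous term -C(n).

open import Algebra.Bundles using (AbelianGroup; CommutativeRing; Monoid; RawGroup)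
import Algebra.Consequences.Setoid as Consequences
import Algebra.Construct.Pointwise as Pointwise
import Algebra.Morphism.GroupMonomorphism as GroupMonomorphism
open import Algebra.Morphism.Structures using (IsGroupMonomorphism)
import Algebra.Properties.AbelianGroup as AbelianGroupProperties
import Algebra.Properties.CommutativeSemigroup as CommutativeSemigroupProperties
import Algebra.Properties.Monoid.Sum as MonoidSum
import Algebra.Properties.Ring as RingProperties
import Algebra.Properties.Semiring.Exp as Exp
import Algebra.Properties.Semiring.Sum as SemiringSum
import Algebra.Solver.Ring as RingSolver
open import Algebra.Solver.Ring.AlmostCommutativeRing using (fromCommutativeRing; _-Raw-AlmostCommutative⟶_)
import Algebra.Solver.Ring.NaturalCoefficients.Default as SemiringSolver
open import Algebra.Structures using (IsAbelianGroup)
open import Data.Empty using (⊥-elim-irr)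
open import Data.Fin.Base using (toℕ)
import Data.Fin.Properties as Fin
open import Data.Integer.Base as ℤ using (ℤ; +_; -[1+_])
open import Data.Integer.DivMod using (div-pos-is-/ℕ; [n/ℕd]*d≤n; n<s[n/ℕd]*d)
import Data.Integer.Properties as ℤ
open import Data.Integer.Solver renaming (module +-*-Solver to ℤ-Solver)
open import Data.List.Base using ([]; _∷_)
open import Data.Maybe.Base as Maybe using (Maybe)
open import Data.Nat.Base as ℕ using (ℕ; zero; suc)
import Data.Nat.Properties as ℕ
open import Data.Rational.Base as ℚ using (ℚ; 0ℚ; 1ℚ)
import Data.Rational.Properties as ℚ
open import Data.Sum.Base using ([_,_]′)
open import Function.Base using (_∘_)
open import Level using (0ℓ)
open import Relation.Binary.Bundles using (Setoid)
open import Relation.Binary.Consequences using (dec⇒weaklyDec)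
open import Relation.Binary.PropositionalEquality as ≡ using (_≡_; cong; cong₂)
import Relation.Binary.Reasoning.Setoid as SetoidReasoning

open import Defs

-- Floor division of integers

i*d<suc[j]*d⇒i≤j : ∀ i j d → i ℤ.* + d ℤ.< ℤ.suc j ℤ.* + d → i ℤ.≤ j
i*d<suc[j]*d⇒i≤j i j d i*d<suc[j]*d = ≡.subst (i ℤ.≤_) (ℤ.pred-suc j)
  (ℤ.i<j⇒i≤pred[j] (ℤ.*-cancelʳ-<-nonNeg {i} {ℤ.suc j} (+ d) i*d<suc[j]*d))

/ℕ-unique : ∀ i j d .{{_ : ℕ.NonZero d}} → j ℤ.* + d ℤ.≤ i → i ℤ.< ℤ.suc j ℤ.* + d → i ℤ./ℕ d ≡ j
/ℕ-unique i j d j*d≤i i<suc[j]*d = ℤ.≤-antisym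
  (i*d<suc[j]*d⇒i≤j (i ℤ./ℕ d) j d (ℤ.≤-<-trans ([n/ℕd]*d≤n i d) i<suc[j]*d))
  (i*d<suc[j]*d⇒i≤j j (i ℤ./ℕ d) d (ℤ.≤-<-trans j*d≤i (n<s[n/ℕd]*d i d)))

[i*d+j]/ℕd≡i+j/ℕd : ∀ i j d .{{_ : ℕ.NonZero d}} → (i ℤ.* + d ℤ.+ j) ℤ./ℕ d ≡ i ℤ.+ j ℤ./ℕ d
[i*d+j]/ℕd≡i+j/ℕd i j d = /ℕ-unique (i ℤ.* + d ℤ.+ j) (i ℤ.+ k) d
  (begin
    (i ℤ.+ k) ℤ.* + d           ≡⟨ ℤ.*-distribʳ-+ (+ d) i k ⟩
    i ℤ.* + d ℤ.+ k ℤ.* + d     ≤⟨ ℤ.+-monoʳ-≤ (i ℤ.* + d) ([n/ℕd]*d≤n j d) ⟩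
    i ℤ.* + d ℤ.+ j             ∎)
  (begin-strict
    i ℤ.* + d ℤ.+ j                    <⟨ ℤ.+-monoʳ-< (i ℤ.* + d) (n<s[n/ℕd]*d j d) ⟩
    i ℤ.* + d ℤ.+ ℤ.suc k ℤ.* + d      ≡⟨ solve 3 (λ i k d → i :* d :+ (con (+ 1) :+ k) :* d
                                                          := (con (+ 1) :+ (i :+ k)) :* d) ≡.refl i k (+ d) ⟩
    ℤ.suc (i ℤ.+ k) ℤ.* + d            ∎)
  where
  open ℤ.≤-Reasoning
  open ℤ-Solver
  k : ℤ
  k = j ℤ./ℕ d

-- The ring of polynomials

+ₚ-0ₚ-rawGroup : RawGroup 0ℓ 0ℓ
+ₚ-0ₚ-rawGroup = record { _≈_ = _≈ₚ_ ; _∙_ = _+ₚ_ ; ε = 0ₚ ; _⁻¹ = -ₚ_ }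

sequenceGroup : AbelianGroup 0ℓ 0ℓ
sequenceGroup = Pointwise.abelianGroup ℕ ℚ.+-0-abelianGroup

coeff-isGroupMonomorphism :
  IsGroupMonomorphism +ₚ-0ₚ-rawGroup (AbelianGroup.rawGroup sequenceGroup) coeff
coeff-isGroupMonomorphism = record
  { isGroupHomomorphism = record
    { isMonoidHomomorphism = record
      { isMagmaHomomorphism = record { isRelHomomorphism = record { cong = at } ; homo = coeff-+ }
      ; ε-homo = λ _ → ≡.refl
      }
    ; ⁻¹-homo = coeff-neg
    }
  ; injective = pointwise
  }

+ₚ-0ₚ-isAbelianGroup : IsAbelianGroup _≈ₚ_ _+ₚ_ 0ₚ -ₚ_
+ₚ-0ₚ-isAbelianGroup = GroupMonomorphism.isAbelianGroup coeff-isGroupMonomorphism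
  (AbelianGroup.isAbelianGroup sequenceGroup)

+ₚ-0ₚ-abelianGroup : AbelianGroup 0ℓ 0ℓ
+ₚ-0ₚ-abelianGroup = record { isAbelianGroup = +ₚ-0ₚ-isAbelianGroup }

open AbelianGroup +ₚ-0ₚ-abelianGroup using () renaming
  ( setoid to ≈ₚ-setoid ; refl to ≈ₚ-refl
  ; ∙-cong to +ₚ-cong ; ∙-congˡ to +ₚ-congˡ
  ; identityʳ to +ₚ-identityʳ ; inverseʳ to -ₚ-inverseʳ ; ⁻¹-cong to -ₚ-cong )
module +ₚ = CommutativeSemigroupProperties (AbelianGroup.commutativeSemigroup +ₚ-0ₚ-abelianGroup)
module ≈ₚ-Reasoning = SetoidReasoning ≈ₚ-setoid

private
  variable
    a b : ℚ
    p p′ r r′ : ℚ[q]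

∷-cong : a ≡ b → p ≈ₚ r → a ∷ p ≈ₚ b ∷ r
∷-cong a≡b p≈r .at zero    = a≡b
∷-cong a≡b p≈r .at (suc i) = p≈r .at i

∷-congˡ : p ≈ₚ r → a ∷ p ≈ₚ a ∷ r
∷-congˡ = ∷-cong ≡.refl

head-≈ : a ∷ p ≈ₚ b ∷ r → a ≡ b
head-≈ eq = eq .at 0

tail-≈ : a ∷ p ≈ₚ b ∷ r → p ≈ₚ r
tail-≈ eq .at i = eq .at (suc i)

·ₚ-cong : a ≡ b → p ≈ₚ r → a ·ₚ p ≈ₚ b ·ₚ r
·ₚ-cong {a} {b} {p} {r} a≡b p≈r .at i = begin
  coeff (a ·ₚ p) i  ≡⟨ coeff-· a p i ⟩
  a ℚ.* coeff p i   ≡⟨ cong₂ ℚ._*_ a≡b (p≈r .at i) ⟩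
  b ℚ.* coeff r i   ≡⟨ coeff-· b r i ⟨
  coeff (b ·ₚ r) i  ∎
  where open ≡.≡-Reasoning

·ₚ-distribˡ : ∀ a p r → a ·ₚ (p +ₚ r) ≈ₚ a ·ₚ p +ₚ a ·ₚ r
·ₚ-distribˡ a []      r       = ≈ₚ-refl
·ₚ-distribˡ a (b ∷ p) []      = ≈ₚ-refl
·ₚ-distribˡ a (b ∷ p) (c ∷ r) = ∷-cong (ℚ.*-distribˡ-+ a b c) (·ₚ-distribˡ a p r)

·ₚ-distribʳ : ∀ a b p → (a ℚ.+ b) ·ₚ p ≈ₚ a ·ₚ p +ₚ b ·ₚ p
·ₚ-distribʳ a b []      = ≈ₚ-refl
·ₚ-distribʳ a b (c ∷ p) = ∷-cong (ℚ.*-distribʳ-+ c a b) (·ₚ-distribʳ a b p)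

·ₚ-assoc : ∀ a b p → (a ℚ.* b) ·ₚ p ≈ₚ a ·ₚ (b ·ₚ p)
·ₚ-assoc a b []      = ≈ₚ-refl
·ₚ-assoc a b (c ∷ p) = ∷-cong (ℚ.*-assoc a b c) (·ₚ-assoc a b p)

·ₚ-identity : ∀ p → 1ℚ ·ₚ p ≈ₚ p
·ₚ-identity []      = ≈ₚ-refl
·ₚ-identity (a ∷ p) = ∷-cong (ℚ.*-identityˡ a) (·ₚ-identity p)

*ₚ-congˡ : ∀ p → r ≈ₚ r′ → p *ₚ r ≈ₚ p *ₚ r′
*ₚ-congˡ []      r≈r′ = ≈ₚ-refl
*ₚ-congˡ (a ∷ p) r≈r′ = +ₚ-cong (·ₚ-cong {a} ≡.refl r≈r′) (∷-congˡ (*ₚ-congˡ p r≈r′))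

*ₚ-congʳ : ∀ p p′ r → p ≈ₚ p′ → p *ₚ r ≈ₚ p′ *ₚ r
*ₚ-congʳ []      p′       r p≈p′ = ≈ₚ-sym (*ₚ-zeroˡ p′ r (≈ₚ-sym p≈p′))
*ₚ-congʳ (a ∷ p) []       r p≈p′ = *ₚ-zeroˡ (a ∷ p) r p≈p′
*ₚ-congʳ (a ∷ p) (b ∷ p′) r p≈p′ =
  +ₚ-cong (·ₚ-cong (head-≈ p≈p′) ≈ₚ-refl) (∷-congˡ (*ₚ-congʳ p p′ r (tail-≈ p≈p′)))

*ₚ-cong : p ≈ₚ p′ → r ≈ₚ r′ → p *ₚ r ≈ₚ p′ *ₚ r′
*ₚ-cong {p} {p′} {r} p≈p′ r≈r′ = ≈ₚ-trans (*ₚ-congʳ p p′ r p≈p′) (*ₚ-congˡ p′ r≈r′)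

*ₚ-distribʳ : ∀ s p r → (p +ₚ r) *ₚ s ≈ₚ p *ₚ s +ₚ r *ₚ s
*ₚ-distribʳ s []      r       = ≈ₚ-refl
*ₚ-distribʳ s (a ∷ p) []      = ≈ₚ-sym (+ₚ-identityʳ ((a ∷ p) *ₚ s))
*ₚ-distribʳ s (a ∷ p) (b ∷ r) = begin
  (a ℚ.+ b) ·ₚ s +ₚ (0ℚ ∷ (p +ₚ r) *ₚ s)
    ≈⟨ +ₚ-cong (·ₚ-distribʳ a b s) (∷-congˡ (*ₚ-distribʳ s p r)) ⟩
  (a ·ₚ s +ₚ b ·ₚ s) +ₚ ((0ℚ ∷ p *ₚ s) +ₚ (0ℚ ∷ r *ₚ s))
    ≈⟨ +ₚ.interchange (a ·ₚ s) (b ·ₚ s) (0ℚ ∷ p *ₚ s) (0ℚ ∷ r *ₚ s) ⟩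
  (a ∷ p) *ₚ s +ₚ (b ∷ r) *ₚ s
    ∎
  where open ≈ₚ-Reasoning

·ₚ-*ₚ-assoc : ∀ a r s → (a ·ₚ r) *ₚ s ≈ₚ a ·ₚ (r *ₚ s)
·ₚ-*ₚ-assoc a []      s = ≈ₚ-refl
·ₚ-*ₚ-assoc a (b ∷ r) s = begin
  (a ℚ.* b) ·ₚ s +ₚ (0ℚ ∷ (a ·ₚ r) *ₚ s)
    ≈⟨ +ₚ-cong (·ₚ-assoc a b s) (∷-cong (≡.sym (ℚ.*-zeroʳ a)) (·ₚ-*ₚ-assoc a r s)) ⟩
  a ·ₚ (b ·ₚ s) +ₚ a ·ₚ (0ℚ ∷ r *ₚ s)
    ≈⟨ ·ₚ-distribˡ a (b ·ₚ s) (0ℚ ∷ r *ₚ s) ⟨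
  a ·ₚ ((b ∷ r) *ₚ s)
    ∎
  where open ≈ₚ-Reasoning

*ₚ-assoc : ∀ p r s → (p *ₚ r) *ₚ s ≈ₚ p *ₚ (r *ₚ s)
*ₚ-assoc []      r s = ≈ₚ-refl
*ₚ-assoc (a ∷ p) r s = begin
  (a ·ₚ r +ₚ (0ℚ ∷ p *ₚ r)) *ₚ s
    ≈⟨ *ₚ-distribʳ s (a ·ₚ r) (0ℚ ∷ p *ₚ r) ⟩
  (a ·ₚ r) *ₚ s +ₚ (0ℚ ∷ p *ₚ r) *ₚ s
    ≈⟨ +ₚ-cong (·ₚ-*ₚ-assoc a r s) (0∷-*ₚ ≡.refl (p *ₚ r) s) ⟩
  a ·ₚ (r *ₚ s) +ₚ (0ℚ ∷ (p *ₚ r) *ₚ s)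
    ≈⟨ +ₚ-congˡ (∷-congˡ (*ₚ-assoc p r s)) ⟩
  (a ∷ p) *ₚ (r *ₚ s)
    ∎
  where open ≈ₚ-Reasoning

*ₚ-zeroʳ : ∀ p → p *ₚ 0ₚ ≈ₚ 0ₚ
*ₚ-zeroʳ []      = ≈ₚ-refl
*ₚ-zeroʳ (a ∷ p) = ∷-≈0 ≡.refl (*ₚ-zeroʳ p)

*ₚ-∷ : ∀ p b r → p *ₚ (b ∷ r) ≈ₚ b ·ₚ p +ₚ (0ℚ ∷ p *ₚ r)
*ₚ-∷ []      b r = ≈ₚ-sym (∷-≈0 ≡.refl ≈ₚ-refl)
*ₚ-∷ (a ∷ p) b r = ∷-cong (cong (ℚ._+ 0ℚ) (ℚ.*-comm a b)) (begin
  a ·ₚ r +ₚ p *ₚ (b ∷ r)                ≈⟨ +ₚ-congˡ (*ₚ-∷ p b r) ⟩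
  a ·ₚ r +ₚ (b ·ₚ p +ₚ (0ℚ ∷ p *ₚ r))   ≈⟨ +ₚ.x∙yz≈y∙xz (a ·ₚ r) (b ·ₚ p) (0ℚ ∷ p *ₚ r) ⟩
  b ·ₚ p +ₚ (a ∷ p) *ₚ r                ∎)
  where open ≈ₚ-Reasoning

*ₚ-comm : ∀ p r → p *ₚ r ≈ₚ r *ₚ p
*ₚ-comm []      r = ≈ₚ-sym (*ₚ-zeroʳ r)
*ₚ-comm (a ∷ p) r = begin
  a ·ₚ r +ₚ (0ℚ ∷ p *ₚ r)  ≈⟨ +ₚ-congˡ (∷-congˡ (*ₚ-comm p r)) ⟩
  a ·ₚ r +ₚ (0ℚ ∷ r *ₚ p)  ≈⟨ *ₚ-∷ r a p ⟨
  r *ₚ (a ∷ p)             ∎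
  where open ≈ₚ-Reasoning

*ₚ-identityˡ : ∀ p → 1ₚ *ₚ p ≈ₚ p
*ₚ-identityˡ p = begin
  1ℚ ·ₚ p +ₚ (0ℚ ∷ [])  ≈⟨ +ₚ-cong (·ₚ-identity p) (∷-≈0 ≡.refl ≈ₚ-refl) ⟩
  p +ₚ 0ₚ               ≈⟨ +ₚ-identityʳ p ⟩
  p                     ∎
  where open ≈ₚ-Reasoning

polynomialRing : CommutativeRing 0ℓ 0ℓ
polynomialRing = record
  { _+_ = _+ₚ_ ; _*_ = _*ₚ_ ; -_ = -ₚ_ ; 0# = 0ₚ ; 1# = 1ₚ
  ; isCommutativeRing = record
    { isRing = record
      { +-isAbelianGroup = +ₚ-0ₚ-isAbelianGroup
      ; *-cong           = *ₚ-cong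
      ; *-assoc          = *ₚ-assoc
      ; *-identity       = comm∧idˡ⇒id *ₚ-comm *ₚ-identityˡ
      ; distrib          = comm∧distrʳ⇒distr +ₚ-cong *ₚ-comm *ₚ-distribʳ
      }
    ; *-comm = *ₚ-comm
    }
  }
  where open Consequences ≈ₚ-setoid

module ℚ[q]-Ring = CommutativeRing polynomialRing
module ℚ[q]-Properties = RingProperties ℚ[q]-Ring.ring
module ℚ[q]-Solver = SemiringSolver ℚ[q]-Ring.commutativeSemiring
module *ₚ = CommutativeSemigroupProperties ℚ[q]-Ring.*-commutativeSemigroup

*ₚ-cancelʳ : ∀ {p r} s → .(s ≉ₚ 0ₚ) → p *ₚ s ≈ₚ r *ₚ s → p ≈ₚ r
*ₚ-cancelʳ {p} {r} s s≉0 ps≈rs =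
  [ x∙y⁻¹≈ε⇒x≈y p r , (λ s≈0 → ⊥-elim-irr (s≉0 s≈0)) ]′ (*ₚ-domain (p +ₚ (-ₚ r)) s (begin
    (p +ₚ (-ₚ r)) *ₚ s         ≈⟨ [y-z]x≈yx-zx s p r ⟩
    p *ₚ s +ₚ (-ₚ (r *ₚ s))    ≈⟨ x≈y⇒x∙y⁻¹≈ε ps≈rs ⟩
    0ₚ                         ∎))
  where
  open ≈ₚ-Reasoning
  open ℚ[q]-Properties

-- The field of rational functions

≈-refl : ∀ {x} → x ≈ x
≈-refl = cross ≈ₚ-refl

≈-sym : ∀ {x y} → x ≈ y → y ≈ x
≈-sym (cross eq) = cross (≈ₚ-sym eq)

≈-trans : ∀ {x y z} → x ≈ y → y ≈ z → x ≈ z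
≈-trans {x} {y} {z} (cross x≈y) (cross y≈z) = cross (*ₚ-cancelʳ (den y) (den≉0 y) (begin
  (num x *ₚ den z) *ₚ den y  ≈⟨ *ₚ.xy∙z≈xz∙y (num x) (den z) (den y) ⟩
  (num x *ₚ den y) *ₚ den z  ≈⟨ *ₚ-cong x≈y ≈ₚ-refl ⟩
  (num y *ₚ den x) *ₚ den z  ≈⟨ *ₚ.xy∙z≈xz∙y (num y) (den x) (den z) ⟩
  (num y *ₚ den z) *ₚ den x  ≈⟨ *ₚ-cong y≈z ≈ₚ-refl ⟩
  (num z *ₚ den y) *ₚ den x  ≈⟨ *ₚ.xy∙z≈xz∙y (num z) (den y) (den x) ⟩
  (num z *ₚ den x) *ₚ den y  ∎))
  where open ≈ₚ-Reasoning

≈-setoid : Setoid 0ℓ 0ℓ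
≈-setoid = record { _≈_ = _≈_ ; isEquivalence = record { refl = ≈-refl ; sym = ≈-sym ; trans = ≈-trans } }

+-cong : ∀ {x x′ y y′} → x ≈ x′ → y ≈ y′ → x + y ≈ x′ + y′
+-cong {x} {x′} {y} {y′} (cross x≈x′) (cross y≈y′) = cross (begin
  (num x *ₚ den y +ₚ num y *ₚ den x) *ₚ (den x′ *ₚ den y′)
    ≈⟨ solve 6 (λ a b c d e f → (a :* d :+ c :* b) :* (e :* f) := (a :* e) :* (d :* f) :+ (c :* f) :* (b :* e))
         ≈ₚ-refl (num x) (den x) (num y) (den y) (den x′) (den y′) ⟩
  (num x *ₚ den x′) *ₚ (den y *ₚ den y′) +ₚ (num y *ₚ den y′) *ₚ (den x *ₚ den x′)
    ≈⟨ +ₚ-cong (*ₚ-cong x≈x′ ≈ₚ-refl) (*ₚ-cong y≈y′ ≈ₚ-refl) ⟩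
  (num x′ *ₚ den x) *ₚ (den y *ₚ den y′) +ₚ (num y′ *ₚ den y) *ₚ (den x *ₚ den x′)
    ≈⟨ solve 6 (λ a b c d e f → (a :* e) :* (f :* d) :+ (c :* f) :* (e :* b) := (a :* d :+ c :* b) :* (e :* f))
         ≈ₚ-refl (num x′) (den x′) (num y′) (den y′) (den x) (den y) ⟩
  (num x′ *ₚ den y′ +ₚ num y′ *ₚ den x′) *ₚ (den x *ₚ den y)
    ∎)
  where
  open ≈ₚ-Reasoning
  open ℚ[q]-Solver

*-cong : ∀ {x x′ y y′} → x ≈ x′ → y ≈ y′ → x * y ≈ x′ * y′
*-cong {x} {x′} {y} {y′} (cross x≈x′) (cross y≈y′) = cross (begin
  (num x *ₚ num y) *ₚ (den x′ *ₚ den y′)   ≈⟨ *ₚ.interchange (num x) (num y) (den x′) (den y′) ⟩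
  (num x *ₚ den x′) *ₚ (num y *ₚ den y′)   ≈⟨ *ₚ-cong x≈x′ y≈y′ ⟩
  (num x′ *ₚ den x) *ₚ (num y′ *ₚ den y)   ≈⟨ *ₚ.interchange (num x′) (den x) (num y′) (den y) ⟩
  (num x′ *ₚ num y′) *ₚ (den x *ₚ den y)   ∎)
  where open ≈ₚ-Reasoning

-‿cong : ∀ {x y} → x ≈ y → - x ≈ - y
-‿cong {x} {y} (cross eq) = cross (begin
  (-ₚ num x) *ₚ den y   ≈⟨ -‿distribˡ-* (num x) (den y) ⟨
  -ₚ (num x *ₚ den y)   ≈⟨ -ₚ-cong eq ⟩
  -ₚ (num y *ₚ den x)   ≈⟨ -‿distribˡ-* (num y) (den x) ⟩
  (-ₚ num y) *ₚ den x   ∎)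
  where
  open ≈ₚ-Reasoning
  open ℚ[q]-Properties

num≈0⇒≈0 : ∀ {x} → num x ≈ₚ 0ₚ → x ≈ 0#
num≈0⇒≈0 {x} n≈0 = cross (*ₚ-zeroˡ (num x) 1ₚ n≈0)

-‿inverseʳ : ∀ x → x - x ≈ 0#
-‿inverseʳ x = num≈0⇒≈0 (begin
  num x *ₚ den x +ₚ (-ₚ num x) *ₚ den x   ≈⟨ *ₚ-distribʳ (den x) (num x) (-ₚ num x) ⟨
  (num x +ₚ (-ₚ num x)) *ₚ den x          ≈⟨ *ₚ-zeroˡ _ (den x) (-ₚ-inverseʳ (num x)) ⟩
  0ₚ                                      ∎)
  where open ≈ₚ-Reasoning

+-comm : ∀ x y → x + y ≈ y + x
+-comm x y = cross (solve 4
  (λ a b c d → (a :* d :+ c :* b) :* (d :* b) := (c :* b :+ a :* d) :* (b :* d))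
  ≈ₚ-refl (num x) (den x) (num y) (den y))
  where open ℚ[q]-Solver

+-assoc : ∀ x y z → (x + y) + z ≈ x + (y + z)
+-assoc x y z = cross (solve 6
  (λ a b c d e f → ((a :* d :+ c :* b) :* f :+ e :* (b :* d)) :* (b :* (d :* f))
                := (a :* (d :* f) :+ (c :* f :+ e :* d) :* b) :* ((b :* d) :* f))
  ≈ₚ-refl (num x) (den x) (num y) (den y) (num z) (den z))
  where open ℚ[q]-Solver

+-identityʳ : ∀ x → x + 0# ≈ x
+-identityʳ x = cross (begin
  (num x *ₚ 1ₚ +ₚ 0ₚ) *ₚ den x   ≈⟨ *ₚ-cong (+ₚ-identityʳ (num x *ₚ 1ₚ)) ≈ₚ-refl ⟩
  (num x *ₚ 1ₚ) *ₚ den x         ≈⟨ *ₚ.xy∙z≈x∙zy (num x) 1ₚ (den x) ⟩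
  num x *ₚ (den x *ₚ 1ₚ)         ∎)
  where open ≈ₚ-Reasoning

*-comm : ∀ x y → x * y ≈ y * x
*-comm x y = cross (*ₚ-cong (*ₚ-comm (num x) (num y)) (*ₚ-comm (den y) (den x)))

*-assoc : ∀ x y z → (x * y) * z ≈ x * (y * z)
*-assoc x y z = cross (*ₚ-cong (*ₚ-assoc (num x) (num y) (num z)) (≈ₚ-sym (*ₚ-assoc (den x) (den y) (den z))))

*-identityʳ : ∀ x → x * 1# ≈ x
*-identityʳ x = cross (*ₚ.xy∙z≈x∙zy (num x) 1ₚ (den x))

*-distribʳ : ∀ z x y → (x + y) * z ≈ x * z + y * z
*-distribʳ z x y = cross (solve 6
  (λ a b c d e f → ((a :* d :+ c :* b) :* e) :* ((b :* f) :* (d :* f))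
                := ((a :* e) :* (d :* f) :+ (c :* e) :* (b :* f)) :* ((b :* d) :* f))
  ≈ₚ-refl (num x) (den x) (num y) (den y) (num z) (den z))
  where open ℚ[q]-Solver

rationalFunctionRing : CommutativeRing 0ℓ 0ℓ
rationalFunctionRing = record
  { _+_ = _+_ ; _*_ = _*_ ; -_ = -_ ; 0# = 0# ; 1# = 1#
  ; isCommutativeRing = record
    { isRing = record
      { +-isAbelianGroup = record
        { isGroup = record
          { isMonoid = record
            { isSemigroup = record
              { isMagma = record { isEquivalence = Setoid.isEquivalence ≈-setoid ; ∙-cong = +-cong }
              ; assoc   = +-assoc
              }
            ; identity = comm∧idʳ⇒id +-comm +-identityʳ
            }
          ; inverse = comm∧invʳ⇒inv +-comm -‿inverseʳ
          ; ⁻¹-cong = -‿cong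
          }
        ; comm = +-comm
        }
      ; *-cong     = *-cong
      ; *-assoc    = *-assoc
      ; *-identity = comm∧idʳ⇒id *-comm *-identityʳ
      ; distrib    = comm∧distrʳ⇒distr +-cong *-comm *-distribʳ
      }
    ; *-comm = *-comm
    }
  }
  where open Consequences ≈-setoid

module ℚ⟨q⟩-Ring = CommutativeRing rationalFunctionRing
open ℚ⟨q⟩-Ring
  using (reflexive; semiring; +-monoid; *-monoid; +-congˡ; +-congʳ; *-congˡ; *-congʳ; *-identityˡ; zeroʳ)
open CommutativeSemigroupProperties ℚ⟨q⟩-Ring.*-commutativeSemigroup using (x∙yz≈y∙xz; xy∙z≈xz∙y)
open Exp semiring using (^-homo-*; ^-assocʳ)
open RingProperties ℚ⟨q⟩-Ring.ring using (-‿involutive)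
open SemiringSum semiring using (*-distribˡ-sum; ∑-distrib-+)

-- The ring solver needs coefficients with a decidable equality, hence the embedding of ℚ.
constant : ℚ → ℚ⟨q⟩
constant a = fromPoly (a ∷ [])

constant-homomorphism : ℚ.+-*-rawRing -Raw-AlmostCommutative⟶ fromCommutativeRing rationalFunctionRing
constant-homomorphism = record
  { ⟦_⟧    = constant
  ; +-homo = λ a b → cross (solve 3 (λ p r o → (p :+ r) :* (o :* o) := (p :* o :+ r :* o) :* o)
                              ≈ₚ-refl (a ∷ []) (b ∷ []) 1ₚ)
  ; *-homo = λ a b → cross (*ₚ-cong (∷-cong (≡.sym (ℚ.+-identityʳ (a ℚ.* b))) (≈ₚ-refl {[]})) (*ₚ-identityˡ 1ₚ))
  ; -‿homo = λ a → cross ≈ₚ-refl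
  ; 0-homo = num≈0⇒≈0 (∷-≈0 ≡.refl ≈ₚ-refl)
  ; 1-homo = cross ≈ₚ-refl
  }
  where open ℚ[q]-Solver

constant-≟ : ∀ a b → Maybe (constant a ≈ constant b)
constant-≟ a b = Maybe.map (reflexive ∘ cong constant) (dec⇒weaklyDec ℚ._≟_ a b)

module ℚ⟨q⟩-Solver = RingSolver ℚ.+-*-rawRing (fromCommutativeRing rationalFunctionRing)
  constant-homomorphism constant-≟

*-cancelʳ : ∀ {x y} z .{{_ : NonZero z}} → x * z ≈ y * z → x ≈ y
*-cancelʳ {x} {y} z {{z≉0}} (cross eq) =
  cross (*ₚ-cancelʳ (num z *ₚ den z) (*ₚ-≉0 (num≉0 z z≉0) (den≉0 z)) (begin
    (num x *ₚ den y) *ₚ (num z *ₚ den z)   ≈⟨ *ₚ.interchange (num x) (den y) (num z) (den z) ⟩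
    (num x *ₚ num z) *ₚ (den y *ₚ den z)   ≈⟨ eq ⟩
    (num y *ₚ num z) *ₚ (den x *ₚ den z)   ≈⟨ *ₚ.interchange (num y) (den x) (num z) (den z) ⟨
    (num y *ₚ den x) *ₚ (num z *ₚ den z)   ∎))
  where open ≈ₚ-Reasoning

x÷y*y≈x : ∀ x y .{{_ : NonZero y}} → (x ÷ y) * y ≈ x
x÷y*y≈x x y = cross (solve 4 (λ a b c d → ((a :* d) :* c) :* b := a :* ((b :* c) :* d))
  ≈ₚ-refl (num x) (den x) (num y) (den y))
  where open ℚ[q]-Solver

open SetoidReasoning ≈-setoid

÷-unique : ∀ {x y z} .{{_ : NonZero y}} → z * y ≈ x → x ÷ y ≈ z
÷-unique {x} {y} {z} z*y≈x = *-cancelʳ y (≈-trans (x÷y*y≈x x y) (≈-sym z*y≈x))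

÷-congʳ : ∀ {x x′ y} .{{_ : NonZero y}} → x ≈ x′ → x ÷ y ≈ x′ ÷ y
÷-congʳ {x} {x′} {y} x≈x′ = ÷-unique (≈-trans (x÷y*y≈x x′ y) (≈-sym x≈x′))

÷-cross : ∀ {a b w x y z} .{{_ : NonZero y}} .{{_ : NonZero z}} →
  a * x * z ≈ b * w * y → a * (x ÷ y) ≈ b * (w ÷ z)
÷-cross {a} {b} {w} {x} {y} {z} {{y≉0}} {{z≉0}} axz≈bwy =
  *-cancelʳ (y * z) {{*-nonZero y≉0 z≉0}} (begin
    a * (x ÷ y) * (y * z)
      ≈⟨ solve 4 (λ a r y z → a :* r :* (y :* z) := a :* (r :* y) :* z) ≈-refl a (x ÷ y) y z ⟩
    a * (x ÷ y * y) * z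
      ≈⟨ *-congʳ (*-congˡ (x÷y*y≈x x y)) ⟩
    a * x * z
      ≈⟨ axz≈bwy ⟩
    b * w * y
      ≈⟨ *-congʳ (*-congˡ (x÷y*y≈x w z)) ⟨
    b * (w ÷ z * z) * y
      ≈⟨ solve 4 (λ b r y z → b :* (r :* z) :* y := b :* r :* (y :* z)) ≈-refl b (w ÷ z) y z ⟩
    b * (w ÷ z) * (y * z)
      ∎)
  where open ℚ⟨q⟩-Solver

-- Integer powers

^ᶻ-⊖ : ∀ x .{{_ : NonZero x}} m n → x ^ᶻ (m ℤ.⊖ n) * x ^ n ≈ x ^ m
^ᶻ-⊖ x         m       zero    = *-identityʳ (x ^ m)
^ᶻ-⊖ x {{x≉0}} zero    (suc n) = x÷y*y≈x 1# (x ^ suc n) {{^-nonZero x≉0 (suc n)}}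
^ᶻ-⊖ x         (suc m) (suc n) = begin
  x ^ᶻ (suc m ℤ.⊖ suc n) * (x * x ^ n)  ≡⟨ cong (λ i → x ^ᶻ i * (x * x ^ n)) (ℤ.[1+m]⊖[1+n]≡m⊖n m n) ⟩
  x ^ᶻ (m ℤ.⊖ n) * (x * x ^ n)          ≈⟨ x∙yz≈y∙xz (x ^ᶻ (m ℤ.⊖ n)) x (x ^ n) ⟩
  x * (x ^ᶻ (m ℤ.⊖ n) * x ^ n)          ≈⟨ *-congˡ (^ᶻ-⊖ x m n) ⟩
  x * x ^ m                             ∎

^ᶻ-homo-*-pos : ∀ x .{{_ : NonZero x}} i n → x ^ᶻ (i ℤ.+ + n) ≈ x ^ᶻ i * x ^ n
^ᶻ-homo-*-pos x         (+ m)    n = ^-homo-* x m n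
^ᶻ-homo-*-pos x {{x≉0}} -[1+ m ] n = *-cancelʳ (x ^ suc m) {{^-nonZero x≉0 (suc m)}} (begin
  x ^ᶻ (n ℤ.⊖ suc m) * x ^ suc m        ≈⟨ ^ᶻ-⊖ x n (suc m) ⟩
  x ^ n                                 ≈⟨ *-identityˡ (x ^ n) ⟨
  1# * x ^ n                            ≈⟨ *-congʳ (^ᶻ-⊖ x 0 (suc m)) ⟨
  x ^ᶻ -[1+ m ] * x ^ suc m * x ^ n     ≈⟨ xy∙z≈xz∙y (x ^ᶻ -[1+ m ]) (x ^ suc m) (x ^ n) ⟩
  x ^ᶻ -[1+ m ] * x ^ n * x ^ suc m     ∎)

^ᶻ-homo-* : ∀ x .{{_ : NonZero x}} i j → x ^ᶻ (i ℤ.+ j) ≈ x ^ᶻ i * x ^ᶻ j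
^ᶻ-homo-* x         i (+ n)    = ^ᶻ-homo-*-pos x i n
^ᶻ-homo-* x {{x≉0}} i -[1+ n ] = *-cancelʳ (x ^ suc n) {{^-nonZero x≉0 (suc n)}} (begin
  x ^ᶻ (i ℤ.+ -[1+ n ]) * x ^ suc n         ≈⟨ ^ᶻ-homo-*-pos x (i ℤ.+ -[1+ n ]) (suc n) ⟨
  x ^ᶻ (i ℤ.+ -[1+ n ] ℤ.+ ℤ.+[1+ n ])      ≡⟨ cong (λ k → x ^ᶻ k) (//-rightDividesˡ ℤ.+[1+ n ] i) ⟩
  x ^ᶻ i                                    ≈⟨ *-identityʳ (x ^ᶻ i) ⟨
  x ^ᶻ i * 1#                               ≈⟨ *-congˡ (^ᶻ-⊖ x 0 (suc n)) ⟨
  x ^ᶻ i * (x ^ᶻ -[1+ n ] * x ^ suc n)      ≈⟨ *-assoc (x ^ᶻ i) (x ^ᶻ -[1+ n ]) (x ^ suc n) ⟨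
  x ^ᶻ i * x ^ᶻ -[1+ n ] * x ^ suc n        ∎)
  where open AbelianGroupProperties ℤ.+-0-abelianGroup using (//-rightDividesˡ)

^ᶻ-^ : ∀ x .{{_ : NonZero x}} i n → (x ^ᶻ i) ^ n ≈ x ^ᶻ (+ n ℤ.* i)
^ᶻ-^ x i zero    = ≈-refl
^ᶻ-^ x i (suc n) = begin
  x ^ᶻ i * (x ^ᶻ i) ^ n         ≈⟨ *-congˡ (^ᶻ-^ x i n) ⟩
  x ^ᶻ i * x ^ᶻ (+ n ℤ.* i)     ≈⟨ ^ᶻ-homo-* x i (+ n ℤ.* i) ⟨
  x ^ᶻ (i ℤ.+ + n ℤ.* i)        ≡⟨ cong (λ k → x ^ᶻ k) (ℤ.suc-* (+ n) i) ⟨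
  x ^ᶻ (ℤ.+[1+ n ] ℤ.* i)       ∎

^ᶻ-[i*d+j]/d : ∀ x .{{_ : NonZero x}} i j d .{{_ : ℕ.NonZero d}} {k} → k ≡ i ℤ.* + d ℤ.+ j →
  x ^ᶻ (k ℤ./ + d) ≈ x ^ᶻ i * x ^ᶻ (j ℤ./ + d)
^ᶻ-[i*d+j]/d x i j d {k} k≡i*d+j = begin
  x ^ᶻ (k ℤ./ + d)                       ≡⟨ cong (λ k → x ^ᶻ (k ℤ./ + d)) k≡i*d+j ⟩
  x ^ᶻ ((i ℤ.* + d ℤ.+ j) ℤ./ + d)       ≡⟨ cong (λ k → x ^ᶻ k) (div-pos-is-/ℕ (i ℤ.* + d ℤ.+ j) d) ⟩
  x ^ᶻ ((i ℤ.* + d ℤ.+ j) ℤ./ℕ d)        ≡⟨ cong (λ k → x ^ᶻ k) ([i*d+j]/ℕd≡i+j/ℕd i j d) ⟩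
  x ^ᶻ (i ℤ.+ j ℤ./ℕ d)                  ≡⟨ cong (λ k → x ^ᶻ (i ℤ.+ k)) (div-pos-is-/ℕ j d) ⟨
  x ^ᶻ (i ℤ.+ j ℤ./ + d)                 ≈⟨ ^ᶻ-homo-* x i (j ℤ./ + d) ⟩
  x ^ᶻ i * x ^ᶻ (j ℤ./ + d)              ∎

-- Finite sums and first-order recurrences

module _ {c ℓ} (M : Monoid c ℓ) where
  private
    module M = Monoid M
    module ∑ = MonoidSum M

  sum-toℕ-last : ∀ n (f : ℕ → M.Carrier) → ∑.sum {suc n} (f ∘ toℕ) M.≈ ∑.sum {n} (f ∘ toℕ) M.∙ f n
  sum-toℕ-last n f = M.trans (∑.sum-init-last {n} (f ∘ toℕ)) (M.∙-cong
    (∑.sum-cong-≋ {n} λ k → M.reflexive (cong f (Fin.toℕ-inject₁ k)))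
    (M.reflexive (cong f (Fin.toℕ-fromℕ n))))

∑-cong : ∀ n {f g} → (∀ k → k ℕ.< n → f k ≈ g k) → ∑< n f ≈ ∑< n g
∑-cong n f≈g = MonoidSum.sum-cong-≋ +-monoid {n} λ k → f≈g (toℕ k) (Fin.toℕ<n k)

∑-last : ∀ n f → ∑< (suc n) f ≈ ∑< n f + f n
∑-last = sum-toℕ-last +-monoid

∑-linear : ∀ n u v f g → u * (∑< n f + v * ∑< n g) ≈ ∑[ k < n ] (u * (f k + v * g k))
∑-linear n u v f g = begin
  u * (∑< n f + v * ∑< n g)                   ≈⟨ *-congˡ (+-congˡ (*-distribˡ-sum {n} v (g ∘ toℕ))) ⟩
  u * (∑< n f + (∑[ k < n ] (v * g k)))       ≈⟨ *-congˡ (∑-distrib-+ {n} (f ∘ toℕ) (λ k → v * g (toℕ k))) ⟨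
  u * (∑[ k < n ] (f k + v * g k))            ≈⟨ *-distribˡ-sum {n} u (λ k → f (toℕ k) + v * g (toℕ k)) ⟩
  (∑[ k < n ] (u * (f k + v * g k)))          ∎

∑-consecutive-pairs : ∀ n {u v w} {f g : ℕ → ℚ⟨q⟩} →
  (∀ k → k ℕ.< n → u * (f k + v * f (suc k)) ≈ w * g k) →
  u * (1# + v) * ∑< (suc n) f ≈ w * ∑< n g + u * (f n + v * f 0)
∑-consecutive-pairs n {u} {v} {w} {f} {g} pairs = begin
  u * (1# + v) * S
    ≈⟨ solve 3 (λ u v S → u :* (con 1ℚ :+ v) :* S := u :* S :+ u :* (v :* S)) ≈-refl u v S ⟩
  u * S + u * (v * (f 0 + B))
    ≈⟨ +-congʳ (*-congˡ (∑-last n f)) ⟩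
  u * (A + f n) + u * (v * (f 0 + B))
    ≈⟨ solve 6 (λ u v A B l h → u :* (A :+ l) :+ u :* (v :* (h :+ B))
         := u :* (A :+ v :* B) :+ u :* (l :+ v :* h)) ≈-refl u v A B (f n) (f 0) ⟩
  u * (A + v * B) + u * (f n + v * f 0)
    ≈⟨ +-congʳ (∑-linear n u v f (f ∘ suc)) ⟩
  (∑[ k < n ] (u * (f k + v * f (suc k)))) + u * (f n + v * f 0)
    ≈⟨ +-congʳ (∑-cong n pairs) ⟩
  (∑[ k < n ] (w * g k)) + u * (f n + v * f 0)
    ≈⟨ +-congʳ (*-distribˡ-sum {n} w (g ∘ toℕ)) ⟨
  w * ∑< n g + u * (f n + v * f 0)
    ∎
  where
  open ℚ⟨q⟩-Solver
  S A B : ℚ⟨q⟩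
  S = ∑< (suc n) f
  A = ∑< n f
  B = ∑< n (f ∘ suc)

Recurrence : (d c b f : ℕ → ℚ⟨q⟩) → Set
Recurrence d c b f = ∀ n → d n * f (suc n) ≈ c n * f n + b n

recurrence-unique : ∀ {d c b f g} → (∀ n → NonZero (d n)) →
  Recurrence d c b f → Recurrence d c b g → f 0 ≈ g 0 → ∀ n → f n ≈ g n
recurrence-unique _ _ _ f₀≈g₀ zero = f₀≈g₀
recurrence-unique {d} {c} {b} {f} {g} d≉0 f-rec g-rec f₀≈g₀ (suc n) =
  *-cancelʳ (d n) {{d≉0 n}} (begin
    f (suc n) * d n      ≈⟨ *-comm (f (suc n)) (d n) ⟩
    d n * f (suc n)      ≈⟨ f-rec n ⟩
    c n * f n + b n      ≈⟨ +-congʳ (*-congˡ (recurrence-unique {d} {c} {b} d≉0 f-rec g-rec f₀≈g₀ n)) ⟩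
    c n * g n + b n      ≈⟨ g-rec n ⟨
    d n * g (suc n)      ≈⟨ *-comm (d n) (g (suc n)) ⟩
    g (suc n) * d n      ∎)

variation-of-constants : ∀ {d c b p s : ℕ → ℚ⟨q⟩} →
  (∀ n → d n * p (suc n) ≈ c n * p n) → (∀ n → c n * (p n * s n) ≈ b n) →
  Recurrence d c b (λ n → p n * ∑< n s)
variation-of-constants {d} {c} {b} {p} {s} p-homogeneous cps≈b n = begin
  d n * (p (suc n) * ∑< (suc n) s)
    ≈⟨ *-assoc (d n) (p (suc n)) (∑< (suc n) s) ⟨
  d n * p (suc n) * ∑< (suc n) s
    ≈⟨ *-cong (p-homogeneous n) (∑-last n s) ⟩
  c n * p n * (∑< n s + s n)
    ≈⟨ solve 4 (λ c p Σ s → c :* p :* (Σ :+ s) := c :* (p :* Σ) :+ c :* (p :* s))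
         ≈-refl (c n) (p n) (∑< n s) (s n) ⟩
  c n * (p n * ∑< n s) + c n * (p n * s n)
    ≈⟨ +-congˡ (cps≈b n) ⟩
  c n * (p n * ∑< n s) + b n
    ∎
  where open ℚ⟨q⟩-Solver

-- q-Pochhammer symbols and q-binomial coefficients

⨾-suc : ∀ a b n → ⟨ a ⨾ b ⟩ (suc n) ≈ ⟨ a ⨾ b ⟩ n * (1# - a * b ^ n)
⨾-suc a b n = sum-toℕ-last *-monoid n (λ j → 1# - a * b ^ j)

1-q^[_] : ℕ → ℚ⟨q⟩
1-q^[ m ] = 1# - q ^ m

1-q^-nonZero : ∀ m .{{_ : ℕ.NonZero m}} → NonZero 1-q^[ m ]
1-q^-nonZero (suc n) = at0-nonZero (λ ()) (at0-+ at0-1 (at0-neg (at0-^ at0-q n)))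

1-q^[m]*[1+q^m]≈1-q^[2*m] : ∀ m → 1-q^[ m ] * (1# + q ^ m) ≈ 1-q^[ 2 ℕ.* m ]
1-q^[m]*[1+q^m]≈1-q^[2*m] m = begin
  1-q^[ m ] * (1# + q ^ m)  ≈⟨ solve 1 (λ x → (con 1ℚ :- x) :* (con 1ℚ :+ x)
                                 := con 1ℚ :- x :^ 2) ≈-refl (q ^ m) ⟩
  1# - (q ^ m) ^ 2          ≈⟨ +-congˡ (-‿cong (^-assocʳ q m 2)) ⟩
  1-q^[ m ℕ.* 2 ]           ≡⟨ cong 1-q^[_] (ℕ.*-comm m 2) ⟩
  1-q^[ 2 ℕ.* m ]           ∎
  where open ℚ⟨q⟩-Solver

⟨q⨾q⟩-suc : ∀ n → ⟨ q ⨾ q ⟩ (suc n) ≈ ⟨ q ⨾ q ⟩ n * 1-q^[ suc n ]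
⟨q⨾q⟩-suc = ⨾-suc q q

⟨q²⨾q⟩-suc : ∀ n → ⟨ q ^ 2 ⨾ q ⟩ (suc n) ≈ ⟨ q ^ 2 ⨾ q ⟩ n * 1-q^[ 2 ℕ.+ n ]
⟨q²⨾q⟩-suc n = ≈-trans (⨾-suc (q ^ 2) q n) (*-congˡ (+-congˡ (-‿cong (≈-sym (^-homo-* q 2 n)))))

⟨q²⨾q²⟩-suc : ∀ n → ⟨ q ^ 2 ⨾ q ^ 2 ⟩ (suc n) ≈ ⟨ q ^ 2 ⨾ q ^ 2 ⟩ n * 1-q^[ 2 ℕ.* suc n ]
⟨q²⨾q²⟩-suc n = ≈-trans (⨾-suc (q ^ 2) (q ^ 2) n) (*-congˡ (+-congˡ (-‿cong (^-assocʳ q 2 (suc n)))))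

qbinom-unique : ∀ n k {x} → x * (⟨ q ⨾ q ⟩ k * ⟨ q ⨾ q ⟩ (n ℕ.∸ k)) ≈ ⟨ q ⨾ q ⟩ n → qbinom n k ≈ x
qbinom-unique n k = ÷-unique {{*-nonZero (⟨q⨾q⟩-nonZero k) (⟨q⨾q⟩-nonZero (n ℕ.∸ k))}}

qbinom-cross : ∀ n k n′ k′ {a b} →
  a * ⟨ q ⨾ q ⟩ n * (⟨ q ⨾ q ⟩ k′ * ⟨ q ⨾ q ⟩ (n′ ℕ.∸ k′)) ≈
  b * ⟨ q ⨾ q ⟩ n′ * (⟨ q ⨾ q ⟩ k * ⟨ q ⨾ q ⟩ (n ℕ.∸ k)) →
  a * qbinom n k ≈ b * qbinom n′ k′
qbinom-cross n k n′ k′ = ÷-cross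
  {{*-nonZero (⟨q⨾q⟩-nonZero k) (⟨q⨾q⟩-nonZero (n ℕ.∸ k))}}
  {{*-nonZero (⟨q⨾q⟩-nonZero k′) (⟨q⨾q⟩-nonZero (n′ ℕ.∸ k′))}}

qbinom-zero : ∀ n → qbinom n 0 ≈ 1#
qbinom-zero n = qbinom-unique n 0 (≈-trans (*-identityˡ _) (*-identityˡ (⟨ q ⨾ q ⟩ n)))

qbinom-diagonal : ∀ n → qbinom n n ≈ 1#
qbinom-diagonal n = qbinom-unique n n (begin
  1# * (⟨ q ⨾ q ⟩ n * ⟨ q ⨾ q ⟩ (n ℕ.∸ n))   ≈⟨ *-identityˡ _ ⟩
  ⟨ q ⨾ q ⟩ n * ⟨ q ⨾ q ⟩ (n ℕ.∸ n)          ≡⟨ cong (λ m → ⟨ q ⨾ q ⟩ n * ⟨ q ⨾ q ⟩ m) (ℕ.n∸n≡0 n) ⟩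
  ⟨ q ⨾ q ⟩ n * 1#                           ≈⟨ *-identityʳ (⟨ q ⨾ q ⟩ n) ⟩
  ⟨ q ⨾ q ⟩ n                                ∎)

qbinom-sucˡ : ∀ {n k} → k ℕ.≤ n → 1-q^[ suc n ] * qbinom n k ≈ 1-q^[ suc (n ℕ.∸ k) ] * qbinom (suc n) k
qbinom-sucˡ {n} {k} k≤n = qbinom-cross n k (suc n) k (begin
  u * F * (Fₖ * ⟨ q ⨾ q ⟩ (suc n ℕ.∸ k))    ≡⟨ cong (λ m → u * F * (Fₖ * ⟨ q ⨾ q ⟩ m)) (ℕ.+-∸-assoc 1 k≤n) ⟩
  u * F * (Fₖ * ⟨ q ⨾ q ⟩ (suc (n ℕ.∸ k)))  ≈⟨ *-congˡ (*-congˡ (⟨q⨾q⟩-suc (n ℕ.∸ k))) ⟩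
  u * F * (Fₖ * (G * v))                    ≈⟨ solve 5 (λ u v F Fₖ G → u :* F :* (Fₖ :* (G :* v))
                                                 := v :* (F :* u) :* (Fₖ :* G)) ≈-refl u v F Fₖ G ⟩
  v * (F * u) * (Fₖ * G)                    ≈⟨ *-congʳ (*-congˡ (⟨q⨾q⟩-suc n)) ⟨
  v * ⟨ q ⨾ q ⟩ (suc n) * (Fₖ * G)          ∎)
  where
  open ℚ⟨q⟩-Solver
  u v F Fₖ G : ℚ⟨q⟩
  u  = 1-q^[ suc n ]
  v  = 1-q^[ suc (n ℕ.∸ k) ]
  F  = ⟨ q ⨾ q ⟩ n
  Fₖ = ⟨ q ⨾ q ⟩ k
  G  = ⟨ q ⨾ q ⟩ (n ℕ.∸ k)

qbinom-suc-suc : ∀ n k → 1-q^[ suc n ] * qbinom n k ≈ 1-q^[ suc k ] * qbinom (suc n) (suc k)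
qbinom-suc-suc n k = qbinom-cross n k (suc n) (suc k) (begin
  u * F * (⟨ q ⨾ q ⟩ (suc k) * G)           ≈⟨ *-congˡ (*-congʳ (⟨q⨾q⟩-suc k)) ⟩
  u * F * (Fₖ * v * G)                      ≈⟨ solve 5 (λ u v F Fₖ G → u :* F :* (Fₖ :* v :* G)
                                                 := v :* (F :* u) :* (Fₖ :* G)) ≈-refl u v F Fₖ G ⟩
  v * (F * u) * (Fₖ * G)                    ≈⟨ *-congʳ (*-congˡ (⟨q⨾q⟩-suc n)) ⟨
  v * ⟨ q ⨾ q ⟩ (suc n) * (Fₖ * G)          ∎)
  where
  open ℚ⟨q⟩-Solver
  u v F Fₖ G : ℚ⟨q⟩
  u  = 1-q^[ suc n ]
  v  = 1-q^[ suc k ]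
  F  = ⟨ q ⨾ q ⟩ n
  Fₖ = ⟨ q ⨾ q ⟩ k
  G  = ⟨ q ⨾ q ⟩ (n ℕ.∸ k)

-- The sum of weighted reciprocals of q-binomial coefficients

q^-[_C2] : ℕ → ℚ⟨q⟩
q^-[ k C2] = q ^ᶻ (ℤ.- (+ k ℤ.* (+ k ℤ.- + 1)) ℤ./ + 2)

-- Floor division by 2 commutes with integer shifts, so the parity of the exponent plays no role.
q^-C2-shift : ∀ i k {j} → j ≡ i ℤ.* + 2 ℤ.- + k ℤ.* (+ k ℤ.- + 1) → q ^ᶻ (j ℤ./ + 2) ≈ q ^ᶻ i * q^-[ k C2]
q^-C2-shift i k = ^ᶻ-[i*d+j]/d q i (ℤ.- (+ k ℤ.* (+ k ℤ.- + 1))) 2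

q^-C2-suc : ∀ k → q^-[ k C2] ≈ q ^ k * q^-[ suc k C2]
q^-C2-suc k = q^-C2-shift (+ k) (suc k) (solve 1 (λ k →
  :- (k :* (k :- con (+ 1))) := k :* con (+ 2) :- (con (+ 1) :+ k) :* (con (+ 1) :+ k :- con (+ 1))) ≡.refl (+ k))
  where open ℤ-Solver

reciprocalTerm : ℕ → ℕ → ℚ⟨q⟩
reciprocalTerm n k = (q^-[ k C2] ÷ qbinom n k) {{qbinom-nonZero n k}}

reciprocalSum : ℕ → ℚ⟨q⟩
reciprocalSum n = ∑[ k < n ] reciprocalTerm n k

reciprocalTerm-cross : ∀ n k n′ k′ {a b} → a * q^-[ k C2] * qbinom n′ k′ ≈ b * q^-[ k′ C2] * qbinom n k →
  a * reciprocalTerm n k ≈ b * reciprocalTerm n′ k′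
reciprocalTerm-cross n k n′ k′ = ÷-cross {{qbinom-nonZero n k}} {{qbinom-nonZero n′ k′}}

reciprocalTerm-zero : ∀ n → reciprocalTerm n 0 ≈ 1#
reciprocalTerm-zero n = ÷-unique {{qbinom-nonZero n 0}} (≈-trans (*-identityˡ (qbinom n 0)) (qbinom-zero n))

reciprocalTerm-diagonal : ∀ n → reciprocalTerm n n ≈ q^-[ n C2]
reciprocalTerm-diagonal n = ÷-unique {{qbinom-nonZero n n}} (begin
  q^-[ n C2] * qbinom n n   ≈⟨ *-congˡ (qbinom-diagonal n) ⟩
  q^-[ n C2] * 1#           ≈⟨ *-identityʳ q^-[ n C2] ⟩
  q^-[ n C2]                ∎)

reciprocalTerm-sucˡ : ∀ {n k} → k ℕ.≤ n →
  1-q^[ suc n ] * reciprocalTerm (suc n) k ≈ 1-q^[ suc (n ℕ.∸ k) ] * reciprocalTerm n k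
reciprocalTerm-sucˡ {n} {k} k≤n = reciprocalTerm-cross (suc n) k n k (begin
  u * P * qbinom n k        ≈⟨ xy∙z≈xz∙y u P (qbinom n k) ⟩
  u * qbinom n k * P        ≈⟨ *-congʳ (qbinom-sucˡ k≤n) ⟩
  v * qbinom (suc n) k * P  ≈⟨ xy∙z≈xz∙y v (qbinom (suc n) k) P ⟩
  v * P * qbinom (suc n) k  ∎)
  where
  u v P : ℚ⟨q⟩
  u = 1-q^[ suc n ]
  v = 1-q^[ suc (n ℕ.∸ k) ]
  P = q^-[ k C2]

reciprocalTerm-suc-suc : ∀ n k →
  1-q^[ suc n ] * q ^ k * reciprocalTerm (suc n) (suc k) ≈ 1-q^[ suc k ] * reciprocalTerm n k
reciprocalTerm-suc-suc n k = reciprocalTerm-cross (suc n) (suc k) n k (begin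
  u * q ^ k * q^-[ suc k C2] * qbinom n k        ≈⟨ *-congʳ (*-assoc u (q ^ k) q^-[ suc k C2]) ⟩
  u * (q ^ k * q^-[ suc k C2]) * qbinom n k      ≈⟨ *-congʳ (*-congˡ (q^-C2-suc k)) ⟨
  u * P * qbinom n k                             ≈⟨ xy∙z≈xz∙y u P (qbinom n k) ⟩
  u * qbinom n k * P                             ≈⟨ *-congʳ (qbinom-suc-suc n k) ⟩
  v * qbinom (suc n) (suc k) * P                 ≈⟨ xy∙z≈xz∙y v (qbinom (suc n) (suc k)) P ⟩
  v * P * qbinom (suc n) (suc k)                 ∎)
  where
  u v P : ℚ⟨q⟩
  u = 1-q^[ suc n ]
  v = 1-q^[ suc k ]
  P = q^-[ k C2]

reciprocalTerm-recurrence : ∀ {n k} → k ℕ.≤ n →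
  1-q^[ suc n ] * (reciprocalTerm (suc n) k + q ^ suc n * reciprocalTerm (suc n) (suc k)) ≈
  1-q^[ 2 ℕ.+ n ] * reciprocalTerm n k
reciprocalTerm-recurrence {n} {k} k≤n = begin
  u * (t₁ + q ^ suc n * t₂)           ≈⟨ *-congˡ (+-congˡ (*-congʳ y*x≈q^[1+n])) ⟨
  u * (t₁ + y * x * t₂)               ≈⟨ solve 5 (λ u x y t₁ t₂ → u :* (t₁ :+ y :* x :* t₂)
                                           := u :* t₁ :+ y :* (u :* x :* t₂)) ≈-refl u x y t₁ t₂ ⟩
  u * t₁ + y * (u * x * t₂)           ≈⟨ +-cong (reciprocalTerm-sucˡ k≤n) (*-congˡ (reciprocalTerm-suc-suc n k)) ⟩
  (1# - y) * t + y * ((1# - q * x) * t)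
                                      ≈⟨ solve 4 (λ q x y t → (con 1ℚ :- y) :* t :+ y :* ((con 1ℚ :- q :* x) :* t)
                                           := (con 1ℚ :- q :* (y :* x)) :* t) ≈-refl q x y t ⟩
  (1# - q * (y * x)) * t              ≈⟨ *-congʳ (+-congˡ (-‿cong (*-congˡ y*x≈q^[1+n]))) ⟩
  1-q^[ 2 ℕ.+ n ] * t                 ∎
  where
  open ℚ⟨q⟩-Solver
  u x y t t₁ t₂ : ℚ⟨q⟩
  u  = 1-q^[ suc n ]
  x  = q ^ k
  y  = q ^ suc (n ℕ.∸ k)
  t  = reciprocalTerm n k
  t₁ = reciprocalTerm (suc n) k
  t₂ = reciprocalTerm (suc n) (suc k)

  y*x≈q^[1+n] : y * x ≈ q ^ suc n
  y*x≈q^[1+n] = begin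
    y * x                       ≈⟨ ^-homo-* q (suc (n ℕ.∸ k)) k ⟨
    q ^ suc (n ℕ.∸ k ℕ.+ k)     ≡⟨ cong (λ m → q ^ suc m) (ℕ.m∸n+n≡m k≤n) ⟩
    q ^ suc n                   ∎

reciprocalTerm-subdiagonal : ∀ n → 1-q^[ suc n ] * reciprocalTerm (suc n) n ≈ 1-q^[ 1 ] * q^-[ n C2]
reciprocalTerm-subdiagonal n = begin
  1-q^[ suc n ] * reciprocalTerm (suc n) n         ≈⟨ reciprocalTerm-sucˡ {n} ℕ.≤-refl ⟩
  1-q^[ suc (n ℕ.∸ n) ] * reciprocalTerm n n       ≡⟨ cong (λ m → 1-q^[ suc m ] * reciprocalTerm n n) (ℕ.n∸n≡0 n) ⟩
  1-q^[ 1 ] * reciprocalTerm n n                   ≈⟨ *-congˡ (reciprocalTerm-diagonal n) ⟩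
  1-q^[ 1 ] * q^-[ n C2]                           ∎

module C-Exponents (n : ℕ) where
  open ℤ-Solver

  private
    i : ℤ
    i = + n

    Q P : ℚ⟨q⟩
    Q = q ^ suc n
    P = q^-[ n C2]

  q^[i+1] : q ^ᶻ (i ℤ.+ + 1) ≈ Q
  q^[i+1] = reflexive (cong (q ^_) (ℕ.+-comm n 1))

  q^_[i+1] : ∀ m → q ^ᶻ (+ m ℤ.* (i ℤ.+ + 1)) ≈ Q ^ m
  q^ m [i+1] = begin
    q ^ᶻ (+ m ℤ.* (i ℤ.+ + 1))    ≈⟨ ^ᶻ-^ q (i ℤ.+ + 1) m ⟨
    (q ^ᶻ (i ℤ.+ + 1)) ^ m        ≡⟨ cong (λ l → (q ^ l) ^ m) (ℕ.+-comm n 1) ⟩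
    Q ^ m                         ∎

  q^-[i+1][i-4]/2 : q ^ᶻ (ℤ.- ((i ℤ.+ + 1) ℤ.* (i ℤ.- + 4)) ℤ./ + 2) ≈ q * Q * P
  q^-[i+1][i-4]/2 = q^-C2-shift (+ 2 ℤ.+ i) n (solve 1 (λ i →
    :- ((i :+ con (+ 1)) :* (i :- con (+ 4)))
    := (con (+ 2) :+ i) :* con (+ 2) :- i :* (i :- con (+ 1))) ≡.refl i)

  q^[2+3i-i²]/2 : q ^ᶻ ((+ 2 ℤ.+ + 3 ℤ.* i ℤ.- i ℤ.* i) ℤ./ + 2) ≈ Q * P
  q^[2+3i-i²]/2 = q^-C2-shift (+ 1 ℤ.+ i) n (solve 1 (λ i →
    con (+ 2) :+ con (+ 3) :* i :- i :* i
    := (con (+ 1) :+ i) :* con (+ 2) :- i :* (i :- con (+ 1))) ≡.refl i)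

  q^-[i+1][i-2]/2 : q ^ᶻ (ℤ.- ((i ℤ.+ + 1) ℤ.* (i ℤ.- + 2)) ℤ./ + 2) ≈ q ^ 1 * P
  q^-[i+1][i-2]/2 = q^-C2-shift (+ 1) n (solve 1 (λ i →
    :- ((i :+ con (+ 1)) :* (i :- con (+ 2)))
    := con (+ 1) :* con (+ 2) :- i :* (i :- con (+ 1))) ≡.refl i)

C-simplified : ∀ n → C n ≈ - (1-q^[ 1 ] * q^-[ n C2] + 1-q^[ suc n ] * q ^ suc n)
C-simplified n = begin
  C n
    ≈⟨ ÷-congʳ {{q^[1+n]-1-nonZero n}} (+-cong (+-cong (+-cong (+-cong (+-cong (+-cong
         q^[i+1] (q^ 3 [i+1])) ≈-refl) q^-[i+1][i-4]/2) (-‿cong q^[2+3i-i²]/2)) (-‿cong q^-[i+1][i-2]/2))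
         (-‿cong (+-cong (q^ 2 [i+1]) (≈-trans (+-identityʳ _) (q^ 2 [i+1]))))) ⟩
  ((Q + Q ^ 3 + P + q * Q * P - Q * P - q ^ 1 * P - (Q ^ 2 + Q ^ 2)) ÷ (Q - 1#)) {{q^[1+n]-1-nonZero n}}
    ≈⟨ ÷-unique {{q^[1+n]-1-nonZero n}} (solve 3 (λ q Q P →
         :- ((con 1ℚ :- q :^ 1) :* P :+ (con 1ℚ :- Q) :* Q) :* (Q :- con 1ℚ)
         := Q :+ Q :^ 3 :+ P :+ q :* Q :* P :- Q :* P :- q :^ 1 :* P :- (Q :^ 2 :+ Q :^ 2)) ≈-refl q Q P) ⟩
  - (1-q^[ 1 ] * P + 1-q^[ suc n ] * Q)
    ∎
  where
  open ℚ⟨q⟩-Solver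
  open C-Exponents n
  Q P : ℚ⟨q⟩
  Q = q ^ suc n
  P = q^-[ n C2]

reciprocalSum-recurrence :
  Recurrence (λ n → 1-q^[ 2 ℕ.* suc n ]) (λ n → 1-q^[ 2 ℕ.+ n ]) (λ n → - C n) reciprocalSum
reciprocalSum-recurrence n = begin
  1-q^[ 2 ℕ.* suc n ] * reciprocalSum (suc n)
    ≈⟨ *-congʳ (1-q^[m]*[1+q^m]≈1-q^[2*m] (suc n)) ⟨
  u * (1# + Q) * reciprocalSum (suc n)
    ≈⟨ ∑-consecutive-pairs n (λ k k<n → reciprocalTerm-recurrence (ℕ.<⇒≤ k<n)) ⟩
  1-q^[ 2 ℕ.+ n ] * reciprocalSum n + u * (reciprocalTerm (suc n) n + Q * reciprocalTerm (suc n) 0)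
    ≈⟨ +-congˡ boundary ⟩
  1-q^[ 2 ℕ.+ n ] * reciprocalSum n - C n
    ∎
  where
  open ℚ⟨q⟩-Solver
  u Q t : ℚ⟨q⟩
  u = 1-q^[ suc n ]
  Q = q ^ suc n
  t = reciprocalTerm (suc n) n

  boundary : u * (t + Q * reciprocalTerm (suc n) 0) ≈ - C n
  boundary = begin
    u * (t + Q * reciprocalTerm (suc n) 0)    ≈⟨ *-congˡ (+-congˡ (*-congˡ (reciprocalTerm-zero (suc n)))) ⟩
    u * (t + Q * 1#)                          ≈⟨ solve 3 (λ u t Q → u :* (t :+ Q :* con 1ℚ)
                                                   := u :* t :+ u :* Q) ≈-refl u t Q ⟩
    u * t + u * Q                             ≈⟨ +-congʳ (reciprocalTerm-subdiagonal n) ⟩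
    1-q^[ 1 ] * q^-[ n C2] + u * Q            ≈⟨ -‿involutive _ ⟨
    - - (1-q^[ 1 ] * q^-[ n C2] + u * Q)      ≈⟨ -‿cong (C-simplified n) ⟨
    - C n                                     ∎

-- The right-hand side

prefactor : ℕ → ℚ⟨q⟩
prefactor n = (⟨ q ^ 2 ⨾ q ⟩ n ÷ ⟨ q ^ 2 ⨾ q ^ 2 ⟩ n) {{⟨q²⨾q²⟩-nonZero n}}

summand : ℕ → ℚ⟨q⟩
summand i = ((C i * ⟨ q ^ 2 ⨾ q ^ 2 ⟩ i) ÷ (⟨ q ^ 2 ⨾ q ⟩ i * (q ^ (2 ℕ.+ i) - 1#)))
  {{*-nonZero (⟨q²⨾q⟩-nonZero i) (q^[1+n]-1-nonZero (suc i))}}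

prefactor-recurrence : ∀ n → 1-q^[ 2 ℕ.* suc n ] * prefactor (suc n) ≈ 1-q^[ 2 ℕ.+ n ] * prefactor n
prefactor-recurrence n = ÷-cross {{⟨q²⨾q²⟩-nonZero (suc n)}} {{⟨q²⨾q²⟩-nonZero n}} (begin
  d * ⟨ q ^ 2 ⨾ q ⟩ (suc n) * E
    ≈⟨ *-congʳ (*-congˡ (⟨q²⨾q⟩-suc n)) ⟩
  d * (H * c) * E
    ≈⟨ solve 4 (λ d c H E → d :* (H :* c) :* E := c :* H :* (E :* d)) ≈-refl d c H E ⟩
  c * H * (E * d)
    ≈⟨ *-congˡ (⟨q²⨾q²⟩-suc n) ⟨
  c * H * ⟨ q ^ 2 ⨾ q ^ 2 ⟩ (suc n)
    ∎)
  where
  open ℚ⟨q⟩-Solver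
  c d E H : ℚ⟨q⟩
  c = 1-q^[ 2 ℕ.+ n ]
  d = 1-q^[ 2 ℕ.* suc n ]
  E = ⟨ q ^ 2 ⨾ q ^ 2 ⟩ n
  H = ⟨ q ^ 2 ⨾ q ⟩ n

prefactor*summand : ∀ n → 1-q^[ 2 ℕ.+ n ] * (prefactor n * summand n) ≈ - C n
prefactor*summand n = *-cancelʳ H {{⟨q²⨾q⟩-nonZero n}} (begin
  (1# - q²⁺ⁿ) * (A * B) * H
    ≈⟨ solve 4 (λ Q A B H → (con 1ℚ :- Q) :* (A :* B) :* H := :- (A :* (B :* (H :* (Q :- con 1ℚ)))))
         ≈-refl q²⁺ⁿ A B H ⟩
  - (A * (B * (H * (q²⁺ⁿ - 1#))))
    ≈⟨ -‿cong (*-congˡ (x÷y*y≈x (C n * E) (H * (q²⁺ⁿ - 1#))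
         {{*-nonZero (⟨q²⨾q⟩-nonZero n) (q^[1+n]-1-nonZero (suc n))}})) ⟩
  - (A * (C n * E))
    ≈⟨ solve 3 (λ A c E → :- (A :* (c :* E)) := :- c :* (A :* E)) ≈-refl A (C n) E ⟩
  - C n * (A * E)
    ≈⟨ *-congˡ (x÷y*y≈x H E {{⟨q²⨾q²⟩-nonZero n}}) ⟩
  - C n * H
    ∎)
  where
  open ℚ⟨q⟩-Solver
  q²⁺ⁿ A B E H : ℚ⟨q⟩
  q²⁺ⁿ = q ^ (2 ℕ.+ n)
  A    = prefactor n
  B    = summand n
  E    = ⟨ q ^ 2 ⨾ q ^ 2 ⟩ n
  H    = ⟨ q ^ 2 ⨾ q ⟩ n

theorem2 : (n : ℕ) → 1 ℕ.≤ n →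
  (∑[ k < n ] ((q ^ᶻ (ℤ.- (+ k ℤ.* (+ k ℤ.- + 1)) ℤ./ + 2) ÷ qbinom n k) {{qbinom-nonZero n k}}))
  ≈ (⟨ q ^ 2 ⨾ q ⟩ n ÷ ⟨ q ^ 2 ⨾ q ^ 2 ⟩ n) {{⟨q²⨾q²⟩-nonZero n}}
    * (∑[ i < n ] (((C i * ⟨ q ^ 2 ⨾ q ^ 2 ⟩ i) ÷ (⟨ q ^ 2 ⨾ q ⟩ i * (q ^ (2 ℕ.+ i) - 1#)))
                     {{*-nonZero (⟨q²⨾q⟩-nonZero i) (q^[1+n]-1-nonZero (suc i))}}))
theorem2 n _ = recurrence-unique (λ n → 1-q^-nonZero (2 ℕ.* suc n))
  reciprocalSum-recurrence
  (variation-of-constants prefactor-recurrence prefactor*summand)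
  (≈-sym (zeroʳ (prefactor 0)))
  n
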